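{- Let $\Sigma$ be a circuit signature with an interpretation $\mathcal I$. The instant feedback rule is sound: for every combinational circuit $F:x+m\to x+n$, the circuit obtained by tracing $F$ over its first $x$ wires and the circuit obtained by unrolling $F$ have the same denotation, $$[\![\mathrm{Tr}^x(F)]\!]^{\mathbf S}_{\mathcal I}=[\![F^{(c)};(\mathrm{stub}_x\otimes\mathrm{id}_n)]\!]^{\mathbf S}_{\mathcal I},$$ where $c$ is the length of the longest chain in the lattice $V^x$ and $F^{(i)}:m\to x+n$ is the $i$-th iteration of $F$, defined by $$F^{(0)}=(\bullet_x\otimes\mathrm{id}_m);F,\qquad F^{(i+1)}=\mathrm{fork}_m;\big((F^{(i)};(\mathrm{id}_x\otimes\mathrm{stub}_n))\otimes\mathrm{id}_m\big);F.$$
   Context: CIRCUITS. A circuit signature $\Sigma=(V,\bullet,P,\mathrm{dom},\mathrm{cod})$ consists of a finite set $V$ of values, an element $\bullet\in V$, a set $P$ of primitive symbols and functions $\mathrm{dom},\mathrm{cod}:P\to\mathbb N$. A PROP is a strict symmetric monoidal category with objects the natural numbers and tensor on objects given by addition. $\mathbf{CCirc}_\Sigma$ (combinational circuits) is the PROP freely generated by $p:\mathrm{dom}(p)\to\mathrm{cod}(p)$ ($p\in P$), $\bullet:0\to1$, fork $1\to2$, join $2\to1$, stub $1\to0$. $\mathbf{SCirc}_\Sigma$ (sequential circuits) is the symmetric traced PROP freely generated by the same generators together with $v:0\to1$ for each $v\in V\setminus\{\bullet\}$ and a delay $\delta:1\to1$. Combinational circuits are regarded as sequential ones. Composition in diagrammatic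 order is written $;$, and the trace is $\mathrm{Tr}^x:\mathrm{Hom}(x+m,x+n)\to\mathrm{Hom}(m,n)$. Multi-wire versions $\bullet_n:0\to n$, $\mathrm{fork}_n:n\to 2n$, $\mathrm{join}_n:2n\to n$, $\mathrm{stub}_n:n\to0$, $\delta_n$ act wirewise. INTERPRETATION AND DENOTATION. An interpretation $\mathcal I=(\sqsubseteq,[\![-]\!])$ of $\Sigma$ is a lattice order $\sqsubseteq$ on $V$ with least element $\bot=\bullet$ and, for each $p\in P$, a monotone function $[\![p]\!]:V^{\mathrm{dom}(p)}\to V^{\mathrm{cod}(p)}$ preserving the all-$\bot$ tuple. $(V^m)^\omega$ is the set of streams (functions $\mathbb N\to V^m$), ordered pointwise. The denotation $[\![F]\!]^{\mathbf S}_{\mathcal I}:(V^m)^\omega\to(V^n)^\omega$ of $F:m\to n$ in $\mathbf{SCirc}_\Sigma$ is defined compositionally: $p$ acts as $[\![p]\!]$ at each time index; fork is $v\mapsto(v,v)$, join is $(v,w)\mapsto v\sqcup w$, stub is $v\mapsto()$, each at every time index; $\bullet$ is the constant stream $\bot$; $v$ is the stream $v,\bot,\bot,\dots$; $\delta$ sends $\sigma$ to $\bot,\sigma(0),\sigma(1),\dots$; composition is function composition, tensor is product, and $\mathrm{Tr}^x(f)(\sigma)=\pi_1(f(\mu,\sigma))$ with $\mu$ the least fixed point of $\tau\mapsto\pi_0(f(\tau,\sigma))$. -}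

module Defs where

open import Data.Nat using (ℕ; zero; suc; _+_; _^_; _≤_; _<_; _⊔_; s≤s)
open import Data.Nat.Properties
  using (+-assoc; +-identityʳ; ≤-refl; ≤-trans; ≤-reflexive; n<1+n; m≤m⊔n; m≤n⊔m;
         m≤m+n; m≤n⇒m≤1+n; m<1+n⇒m<n∨m≡n; m≤n⇒∃[o]m+o≡n; +-suc; +-monoʳ-≤; +-comm)
open import Data.Fin using (Fin; zero; toℕ; combine)
import Data.Fin as Fin
open import Data.Fin.Properties using (pigeonhole; combine-injective)
open import Data.Vec using (Vec; []; _∷_; [_]; _++_; take; drop; replicate)
open import Data.Vec.Relation.Binary.Pointwise.Inductive as Pointwise
  using (Pointwise; []; _∷_; ++⁺)
open import Data.Product using (Σ; ∃; _×_; _,_; proj₁; proj₂)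
open import Data.Sum using (inj₁; inj₂)
open import Function using (_∘_; _↔_; Inverse)
open import Function.Properties.Inverse using (Inverse⇒Injection)
open import Function.Bundles using (Injection)
open import Level using (0ℓ)
open import Relation.Binary using (Rel; Reflexive; Transitive; Antisymmetric; Minimum)
import Relation.Binary.Construct.NonStrictToStrict as NonStrictToStrict
open import Relation.Binary.Lattice using (IsLattice)
open import Relation.Binary.PropositionalEquality
  using (_≡_; _≢_; _≗_; refl; sym; trans; cong; cong₂; subst)

record Signature : Set₁ where
  field
    V      : Set
    finite : ∃ λ k → V ↔ Fin k
    •      : V
    P      : Set
    dom    : P → ℕ
    cod    : P → ℕ

-- Morphisms of the free PROP (and of the free symmetric traced PROP) on a
-- family of generators G, given by representing terms: the morphisms proper
-- are the terms up to the PROP (traced PROP) equations, and everything below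
-- is defined by recursion on representatives.  Composition _⨾_ is in
-- diagrammatic order.  Strictness of the tensor is the identification of
-- propositionally equal objects, along which terms are transported by subst.

infixl 5 _⨾_
infixr 6 _⊗_

data PROP (G : ℕ → ℕ → Set) : ℕ → ℕ → Set where
  gen  : ∀ {m n} → G m n → PROP G m n
  id   : ∀ n → PROP G n n
  _⨾_  : ∀ {m n k} → PROP G m n → PROP G n k → PROP G m k
  _⊗_  : ∀ {m n m′ n′} → PROP G m n → PROP G m′ n′ → PROP G (m + m′) (n + n′)
  swap : ∀ m n → PROP G (m + n) (n + m)

data TracedPROP (G : ℕ → ℕ → Set) : ℕ → ℕ → Set where
  gen  : ∀ {m n} → G m n → TracedPROP G m n
  id   : ∀ n → TracedPROP G n n
  _⨾_  : ∀ {m n k} → TracedPROP G m n → TracedPROP G n k → TracedPROP G m k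
  _⊗_  : ∀ {m n m′ n′} → TracedPROP G m n → TracedPROP G m′ n′ →
         TracedPROP G (m + m′) (n + n′)
  swap : ∀ m n → TracedPROP G (m + n) (n + m)
  Tr   : ∀ x {m n} → TracedPROP G (x + m) (x + n) → TracedPROP G m n

module Circuits (S : Signature) where
  open Signature S

  data CGen : ℕ → ℕ → Set where
    prim : (p : P) → CGen (dom p) (cod p)
    bot  : CGen 0 1
    fork : CGen 1 2
    join : CGen 2 1
    stub : CGen 1 0

  data SGen : ℕ → ℕ → Set where
    comb  : ∀ {m n} → CGen m n → SGen m n
    value : (v : V) → v ≢ • → SGen 0 1
    delay : SGen 1 1

  CCirc SCirc : ℕ → ℕ → Set
  CCirc = PROP CGen
  SCirc = TracedPROP SGen

  ⌜_⌝ : ∀ {m n} → CCirc m n → SCirc m n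
  ⌜ gen g ⌝    = gen (comb g)
  ⌜ id n ⌝     = id n
  ⌜ F ⨾ G ⌝    = ⌜ F ⌝ ⨾ ⌜ G ⌝
  ⌜ F ⊗ G ⌝    = ⌜ F ⌝ ⊗ ⌜ G ⌝
  ⌜ swap m n ⌝ = swap m n

  bots : ∀ n → CCirc 0 n
  bots zero    = id 0
  bots (suc n) = gen bot ⊗ bots n

  stubs : ∀ n → CCirc n 0
  stubs zero    = id 0
  stubs (suc n) = gen stub ⊗ stubs n

  -- The outputs of forks n are the two copies of the n inputs, one block
  -- after the other.
  forks : ∀ n → CCirc n (n + n)
  forks zero    = id 0
  forks (suc n) = subst (CCirc (suc n)) (cong suc (+-assoc n 1 n))
    ((gen fork ⊗ forks n) ⨾ (id 1 ⊗ (swap 1 n ⊗ id n)))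

  iteration : ∀ {x m n} → CCirc (x + m) (x + n) → ℕ → CCirc m (x + n)
  iteration {x} {m} {n} F zero    = (bots x ⊗ id m) ⨾ F
  iteration {x} {m} {n} F (suc i) =
    forks m ⨾
    (subst (CCirc m) (+-identityʳ x) (iteration {x} F i ⨾ (id x ⊗ stubs n)) ⊗ id m) ⨾
    F

record Interpretation (S : Signature) : Set₁ where
  open Signature S

  infix 4 _⊑_ _⊑ⱽ_

  field
    _⊑_       : Rel V 0ℓ
    _∨_ _∧_   : V → V → V
    isLattice : IsLattice _≡_ _⊑_ _∨_ _∧_
    minimum   : Minimum _⊑_ •

  _⊑ⱽ_ : ∀ {n} → Rel (Vec V n) 0ℓ
  _⊑ⱽ_ = Pointwise _⊑_

  ⊥ⱽ : ∀ n → Vec V n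
  ⊥ⱽ n = replicate n •

  field
    ⟦_⟧ᴾ      : (p : P) → Vec V (dom p) → Vec V (cod p)
    monotone  : ∀ p {v w} → v ⊑ⱽ w → ⟦ p ⟧ᴾ v ⊑ⱽ ⟦ p ⟧ᴾ w
    preserves : ∀ p → ⟦ p ⟧ᴾ (⊥ⱽ (dom p)) ≡ ⊥ⱽ (cod p)

-- A chain of length ℓ is v₀ < v₁ < ⋯ < v_ℓ: length counts the steps, so a
-- chain with ℓ + 1 elements has length ℓ.
Chain : {A : Set} → Rel A 0ℓ → ℕ → Set
Chain {A} _≤ᴬ_ ℓ =
  Σ (Fin (suc ℓ) → A) λ v → ∀ {i j} → i Fin.< j → v i <ᴬ v j
  where open NonStrictToStrict _≡_ _≤ᴬ_ renaming (_<_ to _<ᴬ_)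

IsLongestChainLength : {A : Set} → Rel A 0ℓ → ℕ → Set
IsLongestChainLength _≤ᴬ_ c = Chain _≤ᴬ_ c × (∀ ℓ → Chain _≤ᴬ_ ℓ → ℓ ≤ c)

module Denotation {S : Signature} (I : Interpretation S) where
  open Signature S
  open Circuits S
  open Interpretation I
  open IsLattice isLattice using (∨-least; x≤x∨y; y≤x∨y)
    renaming (refl to ⊑-refl; trans to ⊑-trans; antisym to ⊑-antisym)

  infix 4 _⊑ˢ_

  Stream : ℕ → Set
  Stream n = ℕ → Vec V n

  _⊑ˢ_ : ∀ {n} → Rel (Stream n) 0ℓ
  σ ⊑ˢ τ = ∀ t → σ t ⊑ⱽ τ t

  IsLeastFixedPoint : ∀ {n} → (Stream n → Stream n) → Stream n → Set
  IsLeastFixedPoint g μ = g μ ≗ μ × (∀ τ → g τ ≗ τ → μ ⊑ˢ τ)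

  -- Monotonicity and causality in one condition.  Constructively, least
  -- fixed points of stream functions exist for functions of this kind; all
  -- denotations are of this kind.
  IsCausalMonotone : ∀ {m n} → (Stream m → Stream n) → Set
  IsCausalMonotone f =
    ∀ {σ τ} t → (∀ s → s ≤ t → σ s ⊑ⱽ τ s) → f σ t ⊑ⱽ f τ t

  record StreamFunction (m n : ℕ) : Set where
    constructor _,_
    field
      apply          : Stream m → Stream n
      causalMonotone : IsCausalMonotone apply

  open StreamFunction public

  infixr 5 _++ˢ_

  _++ˢ_ : ∀ {m n} → Stream m → Stream n → Stream (m + n)
  (σ ++ˢ τ) t = σ t ++ τ t

  π₀ : ∀ m {n} → Stream (m + n) → Stream m
  π₀ m σ t = take m (σ t)

  π₁ : ∀ m {n} → Stream (m + n) → Stream n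
  π₁ m σ t = drop m (σ t)

  private
    ⊑ⱽ-refl : ∀ {n} → Reflexive (_⊑ⱽ_ {n})
    ⊑ⱽ-refl = Pointwise.refl ⊑-refl

    ⊑ⱽ-trans : ∀ {n} → Transitive (_⊑ⱽ_ {n})
    ⊑ⱽ-trans = Pointwise.trans ⊑-trans

    ⊑ⱽ-antisym : ∀ {n} → Antisymmetric _≡_ (_⊑ⱽ_ {n})
    ⊑ⱽ-antisym []       []       = refl
    ⊑ⱽ-antisym (p ∷ ps) (q ∷ qs) = cong₂ _∷_ (⊑-antisym p q) (⊑ⱽ-antisym ps qs)

    ⊑ⱽ-reflexive : ∀ {n} {v w : Vec V n} → v ≡ w → v ⊑ⱽ w
    ⊑ⱽ-reflexive refl = ⊑ⱽ-refl

    ⊥ⱽ-minimum : ∀ {n} → Minimum (_⊑ⱽ_ {n}) (⊥ⱽ n)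
    ⊥ⱽ-minimum []      = []
    ⊥ⱽ-minimum (v ∷ w) = minimum v ∷ ⊥ⱽ-minimum w

    take⁺ : ∀ m {n} {v w : Vec V (m + n)} → v ⊑ⱽ w → take m v ⊑ⱽ take m w
    take⁺ zero    _        = []
    take⁺ (suc m) (p ∷ ps) = p ∷ take⁺ m ps

    drop⁺ : ∀ m {n} {v w : Vec V (m + n)} → v ⊑ⱽ w → drop m v ⊑ⱽ drop m w
    drop⁺ zero    ps       = ps
    drop⁺ (suc m) (_ ∷ ps) = drop⁺ m ps

    ∨-mono : ∀ {a b c d} → a ⊑ c → b ⊑ d → a ∨ b ⊑ c ∨ d
    ∨-mono p q = ∨-least (⊑-trans p (x≤x∨y _ _)) (⊑-trans q (y≤x∨y _ _))

    encode : ∀ {n} → Vec V n → Fin (proj₁ finite ^ n)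
    encode []      = zero
    encode (v ∷ w) = combine (Inverse.to (proj₂ finite) v) (encode w)

    encode-injective : ∀ {n} (v w : Vec V n) → encode v ≡ encode w → v ≡ w
    encode-injective []      []        _  = refl
    encode-injective (a ∷ v) (b ∷ w) eq
      with p , q ← combine-injective _ (encode v) _ (encode w) eq =
      cong₂ _∷_ (Injection.injective (Inverse⇒Injection (proj₂ finite)) p)
                (encode-injective v w q)

  approx : ∀ {n} → (Stream n → Stream n) → ℕ → Stream n
  approx {n} g zero    = λ _ → ⊥ⱽ n
  approx     g (suc k) = g (approx g k)

  module LeastFixedPoint {n} (g : Stream n → Stream n) (cm : IsCausalMonotone g) where

    private
      g-cong : ∀ {σ τ} t → (∀ s → s ≤ t → σ s ≡ τ s) → g σ t ≡ g τ t
      g-cong t h = ⊑ⱽ-antisym (cm t λ s p → ⊑ⱽ-reflexive (h s p))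
                              (cm t λ s p → ⊑ⱽ-reflexive (sym (h s p)))

      step : ∀ k → approx g k ⊑ˢ approx g (suc k)
      step zero    t = ⊥ⱽ-minimum _
      step (suc k) t = cm t λ s _ → step k s

      climb : ∀ d k → approx g k ⊑ˢ approx g (d + k)
      climb zero    k t = ⊑ⱽ-refl
      climb (suc d) k t = ⊑ⱽ-trans (climb d k t) (step (d + k) t)

      ascending : ∀ {k l} → k ≤ l → approx g k ⊑ˢ approx g l
      ascending {k} k≤l t with d , refl ← m≤n⇒∃[o]m+o≡n k≤l =
        subst (λ l → approx g k t ⊑ⱽ approx g l t) (+-comm d k) (climb d k t)

      Settled : ℕ → Set
      Settled t = ∃ λ K → ∀ k → K ≤ k → ∀ s → s < t → approx g k s ≡ approx g K s

      settled : ∀ t → Settled t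
      settled zero    = 0 , λ _ _ _ ()
      settled (suc t)
        with K , h ← settled t
        with i , j , i<j , eq ← pigeonhole (n<1+n _) (λ i → encode (approx g (K + toℕ i) t))
        = K′ , settle
        where
        K′ = K + toℕ i

        K≤ : ∀ d → K ≤ d + K′
        K≤ d = ≤-trans (m≤m+n K (toℕ i)) (≤-trans (m≤m+n K′ d) (≤-reflexive (+-comm K′ d)))

        once : approx g (suc K′) t ≡ approx g K′ t
        once = ⊑ⱽ-antisym
          (⊑ⱽ-trans
            (ascending (≤-trans (≤-reflexive (sym (+-suc K (toℕ i)))) (+-monoʳ-≤ K i<j)) t)
            (⊑ⱽ-reflexive (sym (encode-injective _ _ eq))))
          (step K′ t)

        now  : ∀ d → approx g (d + K′) t ≡ approx g K′ t
        upto : ∀ d s → s < suc t → approx g (d + K′) s ≡ approx g K′ s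

        now zero    = refl
        now (suc d) = trans (g-cong t λ s s≤t → upto d s (s≤s s≤t)) once

        upto d s s<1+t with m<1+n⇒m<n∨m≡n s<1+t
        ... | inj₁ s<t  = trans (h (d + K′) (K≤ d) s s<t) (sym (h K′ (K≤ 0) s s<t))
        ... | inj₂ refl = now d

        settle : ∀ k → K′ ≤ k → ∀ s → s < suc t → approx g k s ≡ approx g K′ s
        settle k K′≤k s s<1+t with d , refl ← m≤n⇒∃[o]m+o≡n K′≤k =
          subst (λ l → approx g l s ≡ approx g K′ s) (+-comm d K′) (upto d s s<1+t)

    stage : ℕ → ℕ
    stage t = proj₁ (settled (suc t))

    lfp : Stream n
    lfp t = approx g (stage t) t

    approx≡lfp : ∀ t k → stage t ≤ k → approx g k t ≡ lfp t
    approx≡lfp t k p = proj₂ (settled (suc t)) k p t (n<1+n t)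

    approx⊑lfp : ∀ k → approx g k ⊑ˢ lfp
    approx⊑lfp k t = ⊑ⱽ-trans (ascending (m≤m⊔n k (stage t)) t)
      (⊑ⱽ-reflexive (approx≡lfp t (k ⊔ stage t) (m≤n⊔m k (stage t))))

    lfp-isLeastFixedPoint : IsLeastFixedPoint g lfp
    lfp-isLeastFixedPoint = fixed , least
      where
      fixed : g lfp ≗ lfp
      fixed t = trans (g-cong t agree) (approx≡lfp t (suc K) (m≤n⇒m≤1+n ≤-refl))
        where
        K = stage t
        agree : ∀ s → s ≤ t → lfp s ≡ approx g K s
        agree s s≤t = trans (sym (approx≡lfp s (stage s ⊔ K) (m≤m⊔n (stage s) K)))
          (proj₂ (settled (suc t)) (stage s ⊔ K) (m≤n⊔m (stage s) K) s (s≤s s≤t))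

      below : ∀ τ → g τ ≗ τ → ∀ k → approx g k ⊑ˢ τ
      below τ eq zero    t = ⊥ⱽ-minimum _
      below τ eq (suc k) t =
        ⊑ⱽ-trans (cm t λ s _ → below τ eq k s) (⊑ⱽ-reflexive (eq t))

      least : ∀ τ → g τ ≗ τ → lfp ⊑ˢ τ
      least τ eq t = below τ eq (stage t) t

  leastFixedPoint : ∀ {n} (g : Stream n → Stream n) → IsCausalMonotone g →
                    ∃ (IsLeastFixedPoint g)
  leastFixedPoint g cm = lfp , lfp-isLeastFixedPoint
    where open LeastFixedPoint g cm

  module Trace x {m n} (f : StreamFunction (x + m) (x + n)) where

    feedback : Stream m → Stream x → Stream x
    feedback σ τ = π₀ x (apply f (τ ++ˢ σ))

    feedback-causalMonotone : ∀ σ → IsCausalMonotone (feedback σ)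
    feedback-causalMonotone σ t h =
      take⁺ x (causalMonotone f t λ s p → ++⁺ (h s p) ⊑ⱽ-refl)

    μ : Stream m → Stream x
    μ σ = proj₁ (leastFixedPoint (feedback σ) (feedback-causalMonotone σ))

    private
      approx-causalMonotone : ∀ k → IsCausalMonotone (λ σ → approx (feedback σ) k)
      approx-causalMonotone zero    t h = ⊑ⱽ-refl
      approx-causalMonotone (suc k) t h = take⁺ x (causalMonotone f t λ s s≤t →
        ++⁺ (approx-causalMonotone k s λ r r≤s → h r (≤-trans r≤s s≤t)) (h s s≤t))

      μ-causalMonotone : IsCausalMonotone μ
      μ-causalMonotone {σ} {τ} t h = ⊑ⱽ-trans (approx-causalMonotone K t h)
        (LeastFixedPoint.approx⊑lfp (feedback τ) (feedback-causalMonotone τ) K t)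
        where K = LeastFixedPoint.stage (feedback σ) (feedback-causalMonotone σ) t

    trace : StreamFunction m n
    trace = (λ σ → π₁ x (apply f (μ σ ++ˢ σ))) , λ t h →
      drop⁺ x (causalMonotone f t λ s s≤t →
        ++⁺ (μ-causalMonotone s λ r r≤s → h r (≤-trans r≤s s≤t)) (h s s≤t))

  instantaneous : ∀ {m n} (f : Vec V m → Vec V n) → (∀ {v w} → v ⊑ⱽ w → f v ⊑ⱽ f w) →
                  StreamFunction m n
  instantaneous f mono = (λ σ t → f (σ t)) , λ t h → mono (h t ≤-refl)

  constant : ∀ {n} → Stream n → StreamFunction 0 n
  constant σ = (λ _ → σ) , λ _ _ → ⊑ⱽ-refl

  ⟦_⟧ᶜ : ∀ {m n} → CGen m n → StreamFunction m n
  ⟦ prim p ⟧ᶜ = instantaneous ⟦ p ⟧ᴾ (monotone p)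
  ⟦ bot ⟧ᶜ    = constant λ _ → [ • ]
  ⟦ fork ⟧ᶜ   = instantaneous (λ { (v ∷ []) → v ∷ v ∷ [] })
                              (λ { (p ∷ []) → p ∷ p ∷ [] })
  ⟦ join ⟧ᶜ   = instantaneous (λ { (v ∷ w ∷ []) → v ∨ w ∷ [] })
                              (λ { (p ∷ q ∷ []) → ∨-mono p q ∷ [] })
  ⟦ stub ⟧ᶜ   = instantaneous (λ _ → []) (λ _ → [])

  ⟦_⟧ᴳ : ∀ {m n} → SGen m n → StreamFunction m n
  ⟦ comb g ⟧ᴳ    = ⟦ g ⟧ᶜ
  ⟦ value v _ ⟧ᴳ = constant λ { zero → [ v ] ; (suc _) → [ • ] }
  ⟦ delay ⟧ᴳ     = (λ { σ zero → [ • ] ; σ (suc t) → σ t })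
                 , (λ { zero h → ⊑ⱽ-refl ; (suc t) h → h t (m≤n⇒m≤1+n ≤-refl) })

  ⟦_⟧ : ∀ {m n} → SCirc m n → StreamFunction m n
  ⟦ gen g ⟧ = ⟦ g ⟧ᴳ
  ⟦ id n ⟧  = instantaneous (λ v → v) (λ p → p)
  ⟦ F ⨾ G ⟧ = (apply ⟦ G ⟧ ∘ apply ⟦ F ⟧) , λ t h → causalMonotone ⟦ G ⟧ t λ s s≤t →
    causalMonotone ⟦ F ⟧ s λ r r≤s → h r (≤-trans r≤s s≤t)
  ⟦ _⊗_ {m} F G ⟧ = (λ σ → apply ⟦ F ⟧ (π₀ m σ) ++ˢ apply ⟦ G ⟧ (π₁ m σ)) , λ t h →
    ++⁺ (causalMonotone ⟦ F ⟧ t λ s p → take⁺ m (h s p))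
        (causalMonotone ⟦ G ⟧ t λ s p → drop⁺ m (h s p))
  ⟦ swap m n ⟧ = instantaneous (λ v → drop m v ++ take m v)
                               (λ p → ++⁺ (drop⁺ m p) (take⁺ m p))
  ⟦ Tr x F ⟧ = Trace.trace x ⟦ F ⟧

  infix 4 _≈_

  _≈_ : ∀ {m n} → Rel (StreamFunction m n) 0ℓ
  f ≈ g = ∀ σ → apply f σ ≗ apply g σ

{-# OPTIONS --safe #-}
-- The value at time t of a combinational circuit depends on its input only
-- through the value at t.  So, for a fixed input σ, the approximations of the
-- least fixed point of the feedback are at time t the iterates
-- ⊥ ⊑ h ⊥ ⊑ h² ⊥ ⊑ ⋯ of a single function h on Vˣ.  Two consecutive ones among
-- the first c + 2 coincide, as otherwise they form a chain of length c + 1, and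
-- from there on they are constant.  Hence hᶜ ⊥ is the value of the least fixed
-- point, and F⁽ᶜ⁾ applies F to hᶜ ⊥ and the input.
module Submission where

open import Data.Nat using (ℕ; zero; suc; _+_; _<_; _≤′_; ≤′-refl; ≤′-step)
open import Data.Nat.GeneralisedArithmetic using (fold)
open import Data.Nat.Properties using (+-assoc; +-identityʳ; 1+n≰n; ≤⇒≤′; <⇒≤; <-≤-trans)
open import Data.Fin using (toℕ; fromℕ<)
open import Data.Fin.Properties using (any?; toℕ≤pred[n]; toℕ-fromℕ<; _≟_)
open import Data.Vec using (Vec; []; _∷_; [_]; _++_; take; drop; cast)
open import Data.Vec.Properties
  using (≡-dec; cast-is-id; ++-assoc-eqFree; ++-identityʳ-eqFree)
open import Data.Vec.Relation.Binary.Pointwise.Inductive as Pointwise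
  using ([]; _∷_)
open import Data.Product using (_,_; proj₂)
open import Function.Properties.Inverse using (Inverse⇒Injection)
open import Level using (0ℓ)
open import Relation.Nullary using (yes; no; contradiction)
open import Relation.Nullary.Decidable using (via-injection)
open import Relation.Binary using (Rel; IsPartialOrder; DecidableEquality)
open import Relation.Binary.Lattice using (IsLattice)
open import Relation.Binary.PropositionalEquality
  using (_≡_; _≢_; _≗_; refl; sym; trans; cong; cong₂; subst; subst₂;
         isEquivalence; module ≡-Reasoning)
open import Defs

module _ {A : Set} where

  take-++ : ∀ {m n} (v : Vec A m) (w : Vec A n) → take m (v ++ w) ≡ v
  take-++ []      w = refl
  take-++ (a ∷ v) w = cong (a ∷_) (take-++ v w)

  drop-++ : ∀ {m n} (v : Vec A m) (w : Vec A n) → drop m (v ++ w) ≡ w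
  drop-++ []      w = refl
  drop-++ (a ∷ v) w = drop-++ v w

  vec₀≡[] : (v : Vec A 0) → v ≡ []
  vec₀≡[] [] = refl

module _ {A : Set} {_≤ᴬ_ : Rel A 0ℓ} (≤ᴬ-isPartialOrder : IsPartialOrder _≡_ _≤ᴬ_)
         (_≟ᴬ_ : DecidableEquality A) {z : A} {h : A → A}
         (h-mono : ∀ {a b} → a ≤ᴬ b → h a ≤ᴬ h b) (z≤h[z] : z ≤ᴬ h z) where

  private
    module ≤ᴬ = IsPartialOrder ≤ᴬ-isPartialOrder

  fold-step : ∀ k → fold z h k ≤ᴬ fold z h (suc k)
  fold-step zero    = z≤h[z]
  fold-step (suc k) = h-mono (fold-step k)

  fold-ascending : ∀ {k l} → k ≤′ l → fold z h k ≤ᴬ fold z h l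
  fold-ascending ≤′-refl           = ≤ᴬ.refl
  fold-ascending (≤′-step {l} k≤l) = ≤ᴬ.trans (fold-ascending k≤l) (fold-step l)

  fold-fixed-up : ∀ {k l} → k ≤′ l → fold z h (suc k) ≡ fold z h k →
                  fold z h (suc l) ≡ fold z h l
  fold-fixed-up ≤′-refl       eq = eq
  fold-fixed-up (≤′-step k≤l) eq = cong h (fold-fixed-up k≤l eq)

  fold-fixed : ∀ {c} → IsLongestChainLength _≤ᴬ_ c → fold z h (suc c) ≡ fold z h c
  fold-fixed {c} (_ , longest)
    -- Decidable equality makes the search effective. The indices run from 0 to `c`, so a
    -- coincidence occurs no later than `c` and persists up to it.
    with any? {n = suc c} (λ i → fold z h (suc (toℕ i)) ≟ᴬ fold z h (toℕ i))
  ... | yes (i , eq) = fold-fixed-up (≤⇒≤′ (toℕ≤pred[n] i)) eq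
  ... | no never = contradiction (longest (suc c) chain) 1+n≰n
    where
    strict : ∀ {k} → k < suc c → fold z h (suc k) ≢ fold z h k
    strict k<1+c eq = never (fromℕ< k<1+c ,
      subst (λ k → fold z h (suc k) ≡ fold z h k) (sym (toℕ-fromℕ< k<1+c)) eq)

    chain : Chain _≤ᴬ_ (suc c)
    chain = (λ i → fold z h (toℕ i)) , λ {i} {j} i<j →
      fold-ascending (≤⇒≤′ (<⇒≤ i<j)) , λ eq →
      -- If the iterates at `i < j` were equal, the one at `i + 1`, squeezed between them, would
      -- equal the one at `i`. Since `j` is at most `c + 1`, the index `i` lies in the range
      -- searched.
      strict (<-≤-trans i<j (toℕ≤pred[n] j))
        (≤ᴬ.antisym (≤ᴬ.trans (fold-ascending (≤⇒≤′ i<j)) (≤ᴬ.reflexive (sym eq)))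
                    (fold-step (toℕ i)))

module _ {S : Signature} (I : Interpretation S) where
  open Signature S
  open Circuits S
  open Interpretation I
  open Denotation I

  private
    module ⊑ = IsLattice isLattice

  ⊑ⱽ-isPartialOrder : ∀ {n} → IsPartialOrder _≡_ (_⊑ⱽ_ {n})
  ⊑ⱽ-isPartialOrder = record
    { isPreorder = record
      { isEquivalence = isEquivalence
      ; reflexive     = λ { refl → Pointwise.refl ⊑.refl }
      ; trans         = Pointwise.trans ⊑.trans
      }
    ; antisym = antisym
    }
    where
    antisym : ∀ {n} {v w : Vec V n} → v ⊑ⱽ w → w ⊑ⱽ v → v ≡ w
    antisym []       []       = refl
    antisym (p ∷ ps) (q ∷ qs) = cong₂ _∷_ (⊑.antisym p q) (antisym ps qs)

  private
    module ⊑ⱽ {n} = IsPartialOrder (⊑ⱽ-isPartialOrder {n})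

  ⊥ⱽ-minimum : ∀ {n} (v : Vec V n) → ⊥ⱽ n ⊑ⱽ v
  ⊥ⱽ-minimum []      = []
  ⊥ⱽ-minimum (a ∷ v) = minimum a ∷ ⊥ⱽ-minimum v

  _≟ⱽ_ : ∀ {n} → DecidableEquality (Vec V n)
  _≟ⱽ_ = ≡-dec (via-injection (Inverse⇒Injection (proj₂ finite)) _≟_)

  -- Combinational generators have no memory, so a constant stream observed at time 0 already
  -- determines their action on tuples.
  ⟦_⟧ⱽ : ∀ {m n} → CCirc m n → Vec V m → Vec V n
  ⟦ gen g ⟧ⱽ v       = apply ⟦ g ⟧ᶜ (λ _ → v) 0
  ⟦ id n ⟧ⱽ v        = v
  ⟦ F ⨾ G ⟧ⱽ v       = ⟦ G ⟧ⱽ (⟦ F ⟧ⱽ v)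
  ⟦ _⊗_ {m} F G ⟧ⱽ v = ⟦ F ⟧ⱽ (take m v) ++ ⟦ G ⟧ⱽ (drop m v)
  ⟦ swap m n ⟧ⱽ v    = drop m v ++ take m v

  ⟦⟧-combinational : ∀ {m n} (F : CCirc m n) σ t → apply ⟦ ⌜ F ⌝ ⟧ σ t ≡ ⟦ F ⟧ⱽ (σ t)
  ⟦⟧-combinational (gen (prim p)) σ t = refl
  ⟦⟧-combinational (gen bot)      σ t = refl
  ⟦⟧-combinational (gen fork)     σ t = refl
  ⟦⟧-combinational (gen join)     σ t = refl
  ⟦⟧-combinational (gen stub)     σ t = refl
  ⟦⟧-combinational (id n)         σ t = refl
  ⟦⟧-combinational (F ⨾ G)        σ t =
    trans (⟦⟧-combinational G _ t) (cong ⟦ G ⟧ⱽ (⟦⟧-combinational F σ t))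
  ⟦⟧-combinational (_⊗_ {m} F G)  σ t =
    cong₂ _++_ (⟦⟧-combinational F (π₀ m σ) t) (⟦⟧-combinational G (π₁ m σ) t)
  ⟦⟧-combinational (swap m n)     σ t = refl

  -- Turns the transports inside `forks` and `iteration` into `cast`, which computes on vectors and
  -- obeys the associativity and unit laws of `++`.
  ⟦⟧ⱽ-subst : ∀ {m n n′} (eq : n ≡ n′) (F : CCirc m n) v →
              ⟦ subst (CCirc m) eq F ⟧ⱽ v ≡ cast eq (⟦ F ⟧ⱽ v)
  ⟦⟧ⱽ-subst refl F v = sym (cast-is-id refl _)

  ⟦⊗⟧ⱽ-++ : ∀ {m n m′ n′} (F : CCirc m n) (G : CCirc m′ n′) v w →
            ⟦ F ⊗ G ⟧ⱽ (v ++ w) ≡ ⟦ F ⟧ⱽ v ++ ⟦ G ⟧ⱽ w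
  ⟦⊗⟧ⱽ-++ F G v w =
    cong₂ (λ v′ w′ → ⟦ F ⟧ⱽ v′ ++ ⟦ G ⟧ⱽ w′) (take-++ v w) (drop-++ v w)

  ⟦bots⟧ⱽ : ∀ n v → ⟦ bots n ⟧ⱽ v ≡ ⊥ⱽ n
  ⟦bots⟧ⱽ zero    v = vec₀≡[] v
  ⟦bots⟧ⱽ (suc n) v = cong (• ∷_) (⟦bots⟧ⱽ n _)

  ⟦forks⟧ⱽ : ∀ n v → ⟦ forks n ⟧ⱽ v ≡ v ++ v
  ⟦forks⟧ⱽ zero    []      = refl
  ⟦forks⟧ⱽ (suc n) (a ∷ v) = begin
    ⟦ forks (suc n) ⟧ⱽ (a ∷ v)
      ≡⟨ ⟦⟧ⱽ-subst eq ((gen fork ⊗ forks n) ⨾ (id 1 ⊗ (swap 1 n ⊗ id n))) (a ∷ v) ⟩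
    cast eq (a ∷ ⟦ swap 1 n ⊗ id n ⟧ⱽ ((a ∷ []) ++ ⟦ forks n ⟧ⱽ v))
      ≡⟨ cong (λ w → cast eq (a ∷ ⟦ swap 1 n ⊗ id n ⟧ⱽ (a ∷ w))) (⟦forks⟧ⱽ n v) ⟩
    cast eq (a ∷ ⟦ swap 1 n ⊗ id n ⟧ⱽ ((a ∷ v) ++ v))
      -- The swap carries the second copy of `a` past the first copy of `v`. Reassociating then puts
      -- it at the head of the second copy of `v`.
      ≡⟨ cong (λ w → cast eq (a ∷ w)) (⟦⊗⟧ⱽ-++ (swap 1 n) (id n) (a ∷ v) v) ⟩
    a ∷ cast (+-assoc n 1 n) ((v ++ [ a ]) ++ v)
      ≡⟨ cong (a ∷_) (++-assoc-eqFree v [ a ] v) ⟩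
    (a ∷ v) ++ (a ∷ v) ∎
    where
    open ≡-Reasoning
    eq = cong suc (+-assoc n 1 n)

  ⟦id⊗stubs⟧ⱽ : ∀ x n v → cast (+-identityʳ x) (⟦ id x ⊗ stubs n ⟧ⱽ v) ≡ take x v
  ⟦id⊗stubs⟧ⱽ x n v = trans
    (cong (λ w → cast (+-identityʳ x) (take x v ++ w)) (vec₀≡[] _)) (++-identityʳ-eqFree _)

  ⟦stubs⊗id⟧ⱽ : ∀ x n v → ⟦ stubs x ⊗ id n ⟧ⱽ v ≡ drop x v
  ⟦stubs⊗id⟧ⱽ x n v = cong (_++ drop x v) (vec₀≡[] _)

  module _ x {m n} (F : CCirc (x + m) (x + n)) where
    open Trace x ⟦ ⌜ F ⌝ ⟧

    loop : Vec V m → Vec V x → Vec V x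
    loop w v = take x (⟦ F ⟧ⱽ (v ++ w))

    iterates : Vec V m → ℕ → Vec V x
    iterates w = fold (⊥ⱽ x) (loop w)

    feedback≡loop : ∀ σ τ t → feedback σ τ t ≡ loop (σ t) (τ t)
    feedback≡loop σ τ t = cong (take x) (⟦⟧-combinational F (τ ++ˢ σ) t)

    -- Inherited from the causal monotonicity of `feedback` on constant streams at time 0, which
    -- avoids a further induction on circuits.
    loop-mono : ∀ w {u v} → u ⊑ⱽ v → loop w u ⊑ⱽ loop w v
    loop-mono w {u} {v} u⊑v = subst₂ _⊑ⱽ_
      (feedback≡loop (λ _ → w) (λ _ → u) 0) (feedback≡loop (λ _ → w) (λ _ → v) 0)
      (feedback-causalMonotone (λ _ → w) 0 λ _ _ → u⊑v)

    approx≡iterates : ∀ σ k t → approx (feedback σ) k t ≡ iterates (σ t) k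
    approx≡iterates σ zero    t = refl
    approx≡iterates σ (suc k) t =
      trans (feedback≡loop σ _ t) (cong (loop (σ t)) (approx≡iterates σ k t))

    -- Every approximation lies below the least fixed point, which gives one inequality. For the
    -- other, taking the `c`-th iterate at each time yields a fixed point of the feedback, and `μ σ`
    -- is below every fixed point.
    iterates≡μ : ∀ {c} → IsLongestChainLength (_⊑ⱽ_ {x}) c →
                 ∀ σ t → iterates (σ t) c ≡ μ σ t
    iterates≡μ {c} longest σ t = ⊑ⱽ.antisym
      (subst (_⊑ⱽ μ σ t) (approx≡iterates σ c t)
        (LeastFixedPoint.approx⊑lfp (feedback σ) (feedback-causalMonotone σ) c t))
      (proj₂ (proj₂ (leastFixedPoint (feedback σ) (feedback-causalMonotone σ)))
        (λ s → iterates (σ s) c) fixed t)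
      where
      fixed : feedback σ (λ s → iterates (σ s) c) ≗ λ s → iterates (σ s) c
      fixed s = trans (feedback≡loop σ _ s)
        (fold-fixed ⊑ⱽ-isPartialOrder _≟ⱽ_ (loop-mono (σ s)) (⊥ⱽ-minimum _) longest)

    -- The `k`-th iteration contains `k + 1` copies of `F`: the first `k` compute the fed-back
    -- value, and the last one also supplies the output.
    ⟦iteration⟧ⱽ : ∀ k w → ⟦ iteration {x} F k ⟧ⱽ w ≡ ⟦ F ⟧ⱽ (iterates w k ++ w)
    ⟦iteration⟧ⱽ zero    w = cong (λ v → ⟦ F ⟧ⱽ (v ++ w)) (⟦bots⟧ⱽ x _)
    ⟦iteration⟧ⱽ (suc k) w = cong ⟦ F ⟧ⱽ (begin
      ⟦ G ⊗ id m ⟧ⱽ (⟦ forks m ⟧ⱽ w)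
        ≡⟨ cong ⟦ G ⊗ id m ⟧ⱽ (⟦forks⟧ⱽ m w) ⟩
      ⟦ G ⊗ id m ⟧ⱽ (w ++ w)
        ≡⟨ ⟦⊗⟧ⱽ-++ G (id m) w w ⟩
      ⟦ G ⟧ⱽ w ++ w
        ≡⟨ cong (_++ w) (⟦⟧ⱽ-subst (+-identityʳ x) G′ w) ⟩
      cast (+-identityʳ x) (⟦ G′ ⟧ⱽ w) ++ w
        ≡⟨ cong (_++ w) (⟦id⊗stubs⟧ⱽ x n (⟦ iteration {x} F k ⟧ⱽ w)) ⟩
      take x (⟦ iteration {x} F k ⟧ⱽ w) ++ w
        ≡⟨ cong (λ v → take x v ++ w) (⟦iteration⟧ⱽ k w) ⟩
      -- The first `x` outputs of `F` on the `k`-th iterate and `w` are `loop w` of that iterate,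
      -- hence by definition the next iterate.
      iterates w (suc k) ++ w ∎)
      where
      open ≡-Reasoning
      G′ = iteration {x} F k ⨾ (id x ⊗ stubs n)
      G  = subst (CCirc m) (+-identityʳ x) G′

    trace≈iteration : ∀ {c} → IsLongestChainLength (_⊑ⱽ_ {x}) c →
      ⟦ Tr x ⌜ F ⌝ ⟧ ≈ ⟦ ⌜ iteration {x} F c ⨾ (stubs x ⊗ id n) ⌝ ⟧
    trace≈iteration {c} longest σ t = begin
      drop x (apply ⟦ ⌜ F ⌝ ⟧ (μ σ ++ˢ σ) t)
        ≡⟨ cong (drop x) (⟦⟧-combinational F (μ σ ++ˢ σ) t) ⟩
      drop x (⟦ F ⟧ⱽ (μ σ t ++ σ t))
        ≡⟨ cong (λ v → drop x (⟦ F ⟧ⱽ (v ++ σ t))) (iterates≡μ longest σ t) ⟨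
      drop x (⟦ F ⟧ⱽ (iterates (σ t) c ++ σ t))
        ≡⟨ cong (drop x) (⟦iteration⟧ⱽ c (σ t)) ⟨
      drop x (⟦ iteration {x} F c ⟧ⱽ (σ t))
        ≡⟨ ⟦stubs⊗id⟧ⱽ x n _ ⟨
      ⟦ iteration {x} F c ⨾ (stubs x ⊗ id n) ⟧ⱽ (σ t)
        ≡⟨ ⟦⟧-combinational (iteration {x} F c ⨾ (stubs x ⊗ id n)) σ t ⟨
      apply ⟦ ⌜ iteration {x} F c ⨾ (stubs x ⊗ id n) ⌝ ⟧ σ t ∎
      where open ≡-Reasoning

proposition4p13 :
    (S : Signature) (I : Interpretation S) →
    let open Signature S
        open Circuits S
        open Interpretation I
        open Denotation I
    in
    ∀ x m n (F : CCirc (x + m) (x + n)) (c : ℕ) →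
    IsLongestChainLength (_⊑ⱽ_ {x}) c →
    ⟦ Tr x ⌜ F ⌝ ⟧ ≈ ⟦ ⌜ iteration {x} F c ⨾ (stubs x ⊗ id n) ⌝ ⟧
proposition4p13 S I x m n F c = trace≈iteration I x F
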